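{- Let $\Delta \geq 1$ be an integer and let $G$ be a $(3,\Delta)$-bipartite graph. Then $\chi'_s(G) \leq 4\Delta$.
   Context: All graphs are finite, simple and undirected. A strong edge-coloring of a graph $G$ is an assignment of colors to the edges of $G$ such that any two edges that are adjacent, or that are both adjacent to a common third edge, receive different colors (equivalently, every color class is an induced matching). The strong chromatic index $\chi'_s(G)$ is the least number of colors in a strong edge-coloring of $G$. For a set $S$ of vertices, $\Delta(S)$ denotes the maximum degree of vertices of $S$. A $(d_A,d_B)$-bipartite graph is a bipartite graph with parts $A$ and $B$ such that $\Delta(A)\leq d_A$ and $\Delta(B)\leq d_B$. -}

module Defs where

open import Data.Nat using (ℕ; _≤_)
open import Data.Fin using (Fin)
open import Data.Bool using (Bool; true; false; T)
open import Data.List using (length; filter)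
open import Data.Product using (_×_)
open import Data.Sum using (_⊎_)
open import Relation.Nullary using (¬_)
open import Relation.Nullary.Decidable using (T?)
open import Relation.Binary.PropositionalEquality using (_≡_; _≢_)
import Data.Vec as V

record Graph (n : ℕ) : Set where
  field
    adj     : Fin n → Fin n → Bool
    symm    : ∀ u v → adj u v ≡ adj v u
    irrefl  : ∀ u → adj u u ≡ false
open Graph public

Adj : ∀ {n} → Graph n → Fin n → Fin n → Set
Adj G u v = T (adj G u v)

degree : ∀ {n} → Graph n → Fin n → ℕ
degree {n} G v = length (filter (λ w → T? (adj G v w)) (V.toList (V.allFin n)))

record IsBipartiteWith {n} (G : Graph n) (dA dB : ℕ) : Set where
  field
    side      : Fin n → Bool
    crossing  : ∀ u v → Adj G u v → side u ≢ side v
    degA      : ∀ u → side u ≡ false → degree G u ≤ dA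
    degB      : ∀ u → side u ≡ true  → degree G u ≤ dB

SameEdge : ∀ {n} → Fin n → Fin n → Fin n → Fin n → Set
SameEdge u v x y = (u ≡ x × v ≡ y) ⊎ (u ≡ y × v ≡ x)

-- A strong edge-coloring of G with k colors. The color of edge uv is
-- col u v (values on non-edges are irrelevant); it does not depend on the
-- orientation. Two distinct edges uv and xy that are adjacent (share an
-- endpoint) or are joined by an edge (an edge adjacent to both) must get
-- different colors. Since all orientations are quantified over, it
-- suffices to require this when the endpoints u and x are equal or adjacent.
record StrongEdgeColoring {n} (G : Graph n) (k : ℕ) : Set where
  field
    col     : Fin n → Fin n → Fin k
    col-sym : ∀ u v → Adj G u v → col u v ≡ col v u
    strong  : ∀ u v x y → Adj G u v → Adj G x y → ¬ SameEdge u v x y →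
              (u ≡ x ⊎ Adj G u x) → col u v ≢ col x y

StrongChromaticIndex≤ : ∀ {n} → Graph n → ℕ → Set
StrongChromaticIndex≤ G k = StrongEdgeColoring G k

{-# OPTIONS --safe #-}
-- Number the edges at each vertex of B injectively by Fin Δ and give every number i its own
-- palette of four colors. Two edges numbered i conflict exactly when their B-ends are joined by
-- an arc of the digraph D i, where b → b′ if b′ ≠ b is a neighbor of the A-end of the edge
-- numbered i at b; outdegrees in D i are at most 2. So it suffices that every nonempty vertex set
-- S spans a vertex of undirected degree at most 3 in D i. By averaging this can only fail if all
-- outdegrees within S are 2 and S spans no two opposite arcs.
-- To exclude this, choose a numbering that maximizes the number of pairs of equally numbered edges
-- with a common A-end. Renumbering all edges at a to i, by a transposition at each neighbor of a,
-- can only destroy pairs in which some neighbor of a takes part with number i. Hence, by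
-- maximality, every vertex with an out-arc in D i lies on, or has an arc to a vertex on, a pair
-- of opposite arcs.
module Submission where

open import Defs
open import Data.Nat using (ℕ; zero; suc; _+_; _*_; _≤_; _<_; z≤n; s≤s; _<?_)
open import Data.Nat.Properties using (≤-refl; ≤-reflexive; ≤-trans; ≤-<-trans; <-≤-trans; ≮⇒≥; ≤⇒≯; <⇒≱; +-mono-≤; +-mono-<-≤; +-mono-≤-<; +-mono-<; +-monoˡ-≤; +-identityʳ; +-suc; +-cancelʳ-≤; m≤m+n; m≤n+m; +-0-commutativeMonoid; module ≤-Reasoning)
open import Data.Fin using (Fin; zero; suc; _≟_; combine; fromℕ<; inject≤)
open import Data.Fin.Properties using (any?; combine-injective; inject≤-injective)
open import Data.Fin.Permutation.Components using (transpose; transpose-inverse)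
open import Data.Fin.Subset using (Subset; _∈_; _⊂_; _-_; Nonempty; ⊤)
open import Data.Fin.Subset.Properties using (_∈?_; nonempty?; ∈⊤; x∈p⇒p-x⊂p; x∈p∧x≢y⇒x∈p-y)
open import Data.Fin.Subset.Induction using (⊂-wellFounded)
open import Data.Bool using (Bool; true; false; T; not; if_then_else_) renaming (_≟_ to _≟ᵇ_)
open import Data.Bool.Properties using (¬-not)
open import Data.List using (List; length; filter)
open import Data.List.Membership.Propositional using () renaming (_∈_ to _∈ₗ_)
open import Data.List.Membership.Propositional.Properties using (∈-filter⁺)
open import Data.List.Membership.Setoid.Properties using (index-injective)
open import Data.List.Relation.Unary.Any using (index)
import Data.List.Membership.DecPropositional as DecMembership
import Data.Vec as V
open import Data.Vec.Membership.Propositional.Properties using (∈-toList⁺; ∈-allFin⁺)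
open import Data.Product using (∃; ∃₂; _×_; _,_; proj₁; proj₂)
open import Data.Sum using (_⊎_; inj₁; inj₂; [_,_])
open import Function using (_∘_; id)
open import Induction.WellFounded using (Acc; acc)
open import Relation.Nullary using (¬_; Dec; yes; no; does; ¬?; _×-dec_; _⊎-dec_; contradiction)
open import Relation.Nullary.Decidable using (T?; dec-true; dec-false; decidable-stable)
open import Relation.Binary.PropositionalEquality using (_≡_; _≢_; refl; sym; trans; cong; cong₂; subst; setoid)
open import Algebra.Properties.CommutativeMonoid.Sum +-0-commutativeMonoid using (sum; sum-cong-≗; ∑-comm; ∑-distrib-+)

-- Indicators and finite sums.

⟦_⟧ : {P : Set} → Dec P → ℕ
⟦ d ⟧ = if does d then 1 else 0

if-yes : {P A : Set} {x y : A} (d : Dec P) → P → (if does d then x else y) ≡ x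
if-yes d p rewrite dec-true d p = refl

if-no : {P A : Set} {x y : A} (d : Dec P) → ¬ P → (if does d then x else y) ≡ y
if-no d ¬p rewrite dec-false d ¬p = refl

⟦⟧-yes : {P : Set} (d : Dec P) → P → ⟦ d ⟧ ≡ 1
⟦⟧-yes = if-yes

⟦⟧-no : {P : Set} (d : Dec P) → ¬ P → ⟦ d ⟧ ≡ 0
⟦⟧-no = if-no

⟦⟧-least : {P : Set} {m : ℕ} (d : Dec P) → (P → 1 ≤ m) → ⟦ d ⟧ ≤ m
⟦⟧-least (no _)  f = z≤n
⟦⟧-least (yes p) f = f p

⟦⟧-mono : {P Q : Set} (d : Dec P) (e : Dec Q) → (P → Q) → ⟦ d ⟧ ≤ ⟦ e ⟧
⟦⟧-mono d e f = ⟦⟧-least d (λ p → ≤-reflexive (sym (⟦⟧-yes e (f p))))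

⟦⟧≤1 : {P : Set} (d : Dec P) → ⟦ d ⟧ ≤ 1
⟦⟧≤1 (no _)  = z≤n
⟦⟧≤1 (yes _) = ≤-refl

sum-mono-≤ : ∀ {n} {f g : Fin n → ℕ} → (∀ i → f i ≤ g i) → sum f ≤ sum g
sum-mono-≤ {zero}  f≤g = z≤n
sum-mono-≤ {suc n} f≤g = +-mono-≤ (f≤g zero) (sum-mono-≤ (f≤g ∘ suc))

sum-mono-< : ∀ {n} {f g : Fin n → ℕ} → (∀ i → f i ≤ g i) → ∀ i → f i < g i → sum f < sum g
sum-mono-< f≤g zero    fi<gi = +-mono-<-≤ fi<gi (sum-mono-≤ (f≤g ∘ suc))
sum-mono-< f≤g (suc i) fi<gi = +-mono-≤-< (f≤g zero) (sum-mono-< (f≤g ∘ suc) i fi<gi)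

sum<sum⇒∃< : ∀ {n} (f g : Fin n → ℕ) → sum f < sum g → ∃ λ i → f i < g i
sum<sum⇒∃< f g Σf<Σg with any? (λ i → f i <? g i)
... | yes found = found
... | no none   = contradiction Σf<Σg (≤⇒≯ (sum-mono-≤ (λ i → ≮⇒≥ (none ∘ (i ,_)))))

sum-zero : ∀ {n} {f : Fin n → ℕ} → (∀ i → f i ≡ 0) → sum f ≡ 0
sum-zero {zero}  f≡0 = refl
sum-zero {suc n} f≡0 = cong₂ _+_ (f≡0 zero) (sum-zero (f≡0 ∘ suc))

term≤sum : ∀ {n} (f : Fin n → ℕ) i → f i ≤ sum f
term≤sum f zero    = m≤m+n _ _
term≤sum f (suc i) = ≤-trans (term≤sum (f ∘ suc) i) (m≤n+m _ _)

sum-≟ : ∀ {n} (i : Fin n) → sum (λ k → ⟦ i ≟ k ⟧) ≡ 1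
sum-≟ {suc n} zero    = cong suc (sum-zero {n} (λ k → ⟦⟧-no (zero ≟ suc k) (λ ())))
sum-≟ {suc n} (suc i) = sum-≟ i

length-filter-tabulate : ∀ {A : Set} {n} (p : A → Bool) (g : Fin n → A) →
  length (filter (T? ∘ p) (V.toList (V.tabulate g))) ≡ sum (λ i → ⟦ T? (p (g i)) ⟧)
length-filter-tabulate {n = zero}  p g = refl
length-filter-tabulate {n = suc n} p g with p (g zero)
... | true  = cong suc (length-filter-tabulate p (g ∘ suc))
... | false = length-filter-tabulate p (g ∘ suc)

-- Transpositions and free colors.

transpose-right : ∀ {n} (i j : Fin n) → transpose i j j ≡ i
transpose-right i j with j ≟ i
... | yes j≡i = j≡i
... | no  _   rewrite dec-true (j ≟ j) refl = refl

transpose-fixed : ∀ {n} {i j k : Fin n} → k ≢ i → k ≢ j → transpose i j k ≡ k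
transpose-fixed {i = i} {j} {k} k≢i k≢j
  rewrite dec-false (k ≟ i) k≢i | dec-false (k ≟ j) k≢j = refl

transpose-injective : ∀ {n} (i j : Fin n) {k l} → transpose i j k ≡ transpose i j l → k ≡ l
transpose-injective i j eq =
  trans (sym (transpose-inverse j i)) (trans (cong (transpose j i) eq) (transpose-inverse j i))

-- Double counting: each vertex satisfying `P` uses one color, so some color is used less than once.
-- The number `k` is written as a sum of ones to allow a termwise comparison.
avoid-color : ∀ {n k} {P : Fin n → Set} (P? : ∀ v → Dec (P v)) (c : Fin n → Fin k) →
  sum (λ v → ⟦ P? v ⟧) < sum {k} (λ _ → 1) → ∃ λ j → ∀ v → P v → c v ≢ j
avoid-color {n} {k} P? c few =
  let j , unused = sum<sum⇒∃< (λ j → sum (λ v → used j v)) (λ _ → 1)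
                     (≤-<-trans (≤-reflexive (∑-comm used)) (≤-<-trans (sum-mono-≤ uses) few))
  in j , λ v Pv cv≡j → contradiction
       (≤-trans (≤-reflexive (sym (⟦⟧-yes (P? v ×-dec c v ≟ j) (Pv , cv≡j)))) (term≤sum (used j) v))
       (<⇒≱ unused)
  where
  used : Fin k → Fin n → ℕ
  used j v = ⟦ P? v ×-dec c v ≟ j ⟧
  uses : ∀ v → sum (λ j → used j v) ≤ ⟦ P? v ⟧
  uses v with P? v
  ... | yes _ = ≤-reflexive (sum-≟ (c v))
  ... | no  _ = ≤-reflexive (sum-zero {k} (λ _ → refl))

-- Four-coloring a digraph by degeneracy.

module FourColoring {n} {R : Fin n → Fin n → Set} (R? : ∀ u v → Dec (R u v))
  (loopless : ∀ u → ¬ R u u)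
  (outdegree≤2 : ∀ u → sum (λ v → ⟦ R? u v ⟧) ≤ 2)
  (near-opposite : ∀ {u v} → R u v → ∃₂ λ x y → (u ≡ x ⊎ R u x) × R x y × R y x)
  where

  Nbr : Subset n → Fin n → Fin n → Set
  Nbr p u v = v ∈ p × (R u v ⊎ R v u)

  Nbr? : ∀ p u v → Dec (Nbr p u v)
  Nbr? p u v = v ∈? p ×-dec (R? u v ⊎-dec R? v u)

  module _ (p : Subset n) where

    Arc : Fin n → Fin n → Set
    Arc u v = u ∈ p × v ∈ p × R u v

    Arc? : ∀ u v → Dec (Arc u v)
    Arc? u v = u ∈? p ×-dec (v ∈? p ×-dec R? u v)

    Edge? : ∀ u v → Dec (u ∈ p × Nbr p u v)
    Edge? u v = u ∈? p ×-dec Nbr? p u v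

    -- `cap` is 2 on `p` and 0 off `p`, so that the bound on outdegrees within `p` can be summed
    -- over all vertices.
    out cap : Fin n → ℕ
    out u = sum (λ v → ⟦ Arc? u v ⟧)
    cap u = ⟦ u ∈? p ⟧ + ⟦ u ∈? p ⟧

    out≤cap : ∀ u → out u ≤ cap u
    out≤cap u with u ∈? p
    ... | yes u∈p = ≤-trans (sum-mono-≤ (λ v → ⟦⟧-mono (v ∈? p ×-dec R? u v) (R? u v) proj₂)) (outdegree≤2 u)
    ... | no  _   = ≤-reflexive (sum-zero {n} (λ _ → refl))

    both : Fin n → Fin n → ℕ
    both u v = ⟦ Arc? u v ⟧ + ⟦ Arc? v u ⟧

    sum-both : sum (λ u → sum (both u)) ≡ sum out + sum out
    sum-both = trans (sum-cong-≗ (λ u → ∑-distrib-+ (λ v → ⟦ Arc? u v ⟧) (λ v → ⟦ Arc? v u ⟧)))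
      (trans (∑-distrib-+ out (λ u → sum (λ v → ⟦ Arc? v u ⟧)))
             (cong (sum out +_) (∑-comm (λ u v → ⟦ Arc? v u ⟧))))

    Edge≤both : ∀ u v → ⟦ Edge? u v ⟧ ≤ both u v
    Edge≤both u v = ⟦⟧-least (Edge? u v) λ
      { (u∈p , v∈p , inj₁ r) → ≤-trans (≤-reflexive (sym (⟦⟧-yes (Arc? u v) (u∈p , v∈p , r)))) (m≤m+n _ _)
      ; (u∈p , v∈p , inj₂ r) → ≤-trans (≤-reflexive (sym (⟦⟧-yes (Arc? v u) (v∈p , u∈p , r)))) (m≤n+m _ _) }

    -- Two opposite arcs count twice on the right but yield a single undirected neighbor.
    Edge<both : ∀ {u v} → Arc u v → Arc v u → ⟦ Edge? u v ⟧ < both u v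
    Edge<both {u} {v} uv vu rewrite ⟦⟧-yes (Arc? u v) uv | ⟦⟧-yes (Arc? v u) vu = s≤s (⟦⟧≤1 (Edge? u v))

    -- An arc leaving `p` would use up one of the at most two out-arcs at `u`, leaving at most one
    -- inside `p`.
    out-closed : ∀ {u v} → ¬ out u < 2 → R u v → v ∈ p
    out-closed {u} {v} full r with v ∈? p
    ... | yes v∈p = v∈p
    ... | no  v∉p = contradiction (<-≤-trans (sum-mono-< Arc≤R v Arc<R) (outdegree≤2 u)) full
      where
      Arc≤R : ∀ w → ⟦ Arc? u w ⟧ ≤ ⟦ R? u w ⟧
      Arc≤R w = ⟦⟧-mono (Arc? u w) (R? u w) (proj₂ ∘ proj₂)
      Arc<R : ⟦ Arc? u v ⟧ < ⟦ R? u v ⟧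
      Arc<R rewrite ⟦⟧-no (Arc? u v) (v∉p ∘ proj₁ ∘ proj₂) | ⟦⟧-yes (R? u v) r = ≤-refl

    -- A vertex `u` with two arcs inside `p` has some out-arc, so `near-opposite` applies. By
    -- `out-closed`, first `x` and then `y` lie in `p`, unless `x` is itself deficient.
    deficient-or-opposite : Nonempty p → (∃ λ u → u ∈ p × out u < 2) ⊎ (∃₂ λ x y → Arc x y × Arc y x)
    deficient-or-opposite (u , u∈p) with out u <? 2
    ... | yes few = inj₁ (u , u∈p , few)
    ... | no  full
      with v , arc ← sum<sum⇒∃< (λ _ → 0) (λ v → ⟦ Arc? u v ⟧)
                       (≤-<-trans (≤-reflexive (sum-zero {n} (λ _ → refl))) (≤-trans (s≤s z≤n) (≮⇒≥ full)))
      with Arc? u v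
    ... | no ¬arc = contradiction arc (≤⇒≯ (≤-reflexive (⟦⟧-no (Arc? u v) ¬arc)))
    ... | yes (_ , _ , ruv)
      with x , y , u→x , rxy , ryx ← near-opposite ruv
      with x∈p ← [ (λ u≡x → subst (_∈ p) u≡x u∈p) , out-closed full ] u→x
      with out x <? 2
    ... | yes few  = inj₁ (x , x∈p , few)
    ... | no  full′ =
      let y∈p = out-closed full′ rxy in inj₂ (x , y , (x∈p , y∈p , rxy) , (y∈p , x∈p , ryx))

    -- The degrees sum to at most twice the number of arcs, which is at most four times the size of
    -- `p`. A pair of opposite arcs makes the first inequality strict, a deficient vertex the
    -- second.
    sum-degrees< : Nonempty p →
      sum (λ u → sum (λ v → ⟦ Edge? u v ⟧)) < sum (λ u → cap u + cap u)
    sum-degrees< ne rewrite ∑-distrib-+ cap cap with deficient-or-opposite ne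
    ... | inj₁ (u , u∈p , few) =
      ≤-<-trans (≤-trans (sum-mono-≤ (λ u → sum-mono-≤ (Edge≤both u))) (≤-reflexive sum-both))
                (+-mono-< out<cap out<cap)
      where
      out<cap : sum out < sum cap
      out<cap = sum-mono-< out≤cap u
        (<-≤-trans few (≤-reflexive (sym (cong₂ _+_ (⟦⟧-yes (u ∈? p) u∈p) (⟦⟧-yes (u ∈? p) u∈p)))))
    ... | inj₂ (x , y , xy , yx) =
      <-≤-trans (sum-mono-< (λ u → sum-mono-≤ (Edge≤both u)) x (sum-mono-< (Edge≤both x) y (Edge<both xy yx)))
                (≤-trans (≤-reflexive sum-both) (+-mono-≤ (sum-mono-≤ out≤cap) (sum-mono-≤ out≤cap)))

    low-degree : Nonempty p → ∃ λ u → u ∈ p × sum (λ v → ⟦ Nbr? p u v ⟧) < 4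
    low-degree ne
      with u , deg< ← sum<sum⇒∃< (λ u → sum (λ v → ⟦ Edge? u v ⟧)) (λ u → cap u + cap u) (sum-degrees< ne)
      with u ∈? p
    ... | yes u∈p = u , u∈p , deg<
    -- Off `p` the bound given by `cap` is 0, so no strict inequality can occur there.
    ... | no  _   = contradiction deg< (λ ())

  ColorableOn : Subset n → Set
  ColorableOn p = ∃ λ (c : Fin n → Fin 4) → ∀ {u v} → u ∈ p → v ∈ p → R u v → c u ≢ c v

  -- Delete a vertex of degree at most 3, color the rest by induction, and give the vertex a color
  -- that its in- and out-neighbors leave free.
  colorable-on : ∀ p → Acc _⊂_ p → ColorableOn p
  colorable-on p (acc rec) with nonempty? p
  ... | no empty = (λ _ → zero) , λ u∈p _ _ _ → empty (_ , u∈p)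
  ... | yes ne
    with u , u∈p , few ← low-degree p ne
    with c , proper ← colorable-on (p - u) (rec (x∈p⇒p-x⊂p u∈p))
    with k , unused ← avoid-color (Nbr? p u) c few = c′ , proper′
    where
    c′ : Fin n → Fin 4
    c′ v = if does (v ≟ u) then k else c v
    proper′ : ∀ {v w} → v ∈ p → w ∈ p → R v w → c′ v ≢ c′ w
    proper′ {v} {w} v∈p w∈p r with v ≟ u | w ≟ u
    ... | yes refl | yes refl = contradiction r (loopless u)
    ... | yes refl | no  _    = unused w (w∈p , inj₁ r) ∘ sym
    ... | no  _    | yes refl = unused v (v∈p , inj₂ r)
    ... | no  v≢u  | no  w≢u  = proper (x∈p∧x≢y⇒x∈p-y v∈p v≢u) (x∈p∧x≢y⇒x∈p-y w∈p w≢u) r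

  four-colorable : ∃ λ (c : Fin n → Fin 4) → ∀ {u v} → R u v → c u ≢ c v
  four-colorable = let c , proper = colorable-on ⊤ (⊂-wellFounded ⊤) in c , proper ∈⊤ ∈⊤

-- Bounded maximization and numbering of lists.

maximize : ∀ {L : Set} {Stable : L → Set} (Φ : L → ℕ) (bound : ℕ) → (∀ l → Φ l ≤ bound) →
  (∀ l → Stable l ⊎ ∃ λ l′ → Φ l < Φ l′) → L → ∃ Stable
maximize {L} {Stable} Φ bound Φ≤ step l₀ = go bound l₀ (m≤n+m bound (Φ l₀))
  where
  -- The fuel `k` bounds the number of improvements still possible: each raises `Φ` by at least one,
  -- and without fuel `l` already attains `bound`.
  go : ∀ k l → bound ≤ Φ l + k → ∃ Stable
  go k l slack with step l
  ... | inj₁ stable = l , stable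
  go zero l slack | inj₂ (l′ , lt) =
    contradiction (<-≤-trans lt (Φ≤ l′)) (≤⇒≯ (≤-trans slack (≤-reflexive (+-identityʳ _))))
  go (suc k) l slack | inj₂ (l′ , lt) =
    go k l′ (≤-trans slack (≤-trans (≤-reflexive (+-suc (Φ l) k)) (+-monoˡ-≤ k lt)))

-- The number of an element is its position in the list; `1 ≤ k` supplies a default value off the
-- list.
number-list : ∀ {n k} → 1 ≤ k → (xs : List (Fin n)) → length xs ≤ k →
  ∃ λ (f : Fin n → Fin k) → ∀ {x y} → x ∈ₗ xs → y ∈ₗ xs → f x ≡ f y → x ≡ y
number-list {n} {k} 1≤k xs len≤k = f , injective
  where
  open DecMembership (_≟_ {n}) renaming (_∈?_ to _∈ₗ?_)
  f : Fin n → Fin k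
  f x with x ∈ₗ? xs
  ... | yes x∈ = inject≤ (index x∈) len≤k
  ... | no  _  = fromℕ< 1≤k
  injective : ∀ {x y} → x ∈ₗ xs → y ∈ₗ xs → f x ≡ f y → x ≡ y
  injective {x} {y} x∈ y∈ eq with x ∈ₗ? xs | y ∈ₗ? xs
  ... | yes x∈′ | yes y∈′ = index-injective (setoid (Fin n)) x∈′ y∈′ (inject≤-injective len≤k len≤k _ _ eq)
  ... | no  x∉  | _       = contradiction x∈ x∉
  ... | yes _   | no  y∉  = contradiction y∈ y∉

-- Edge numberings and their potential.

module Bipartite {n} (Δ : ℕ) (1≤Δ : 1 ≤ Δ) (G : Graph n) (bip : IsBipartiteWith G 3 Δ) where
  open IsBipartiteWith bip

  Inc : Fin n → Fin n → Set
  Inc b a = side b ≡ true × Adj G b a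

  Inc? : ∀ b a → Dec (Inc b a)
  Inc? b a = side b ≟ᵇ true ×-dec T? (adj G b a)

  Adj-sym : ∀ {u v} → Adj G u v → Adj G v u
  Adj-sym {u} {v} = subst T (symm G u v)

  Inc⇒sideA : ∀ {b a} → Inc b a → side a ≡ false
  Inc⇒sideA {b} {a} (b∈B , ba) = ¬-not (λ a∈B → crossing b a ba (trans b∈B (sym a∈B)))

  Numbering : Set
  Numbering = ∃ λ (lab : Fin n → Fin n → Fin Δ) →
    ∀ {b a a′} → Inc b a → Inc b a′ → lab b a ≡ lab b a′ → a ≡ a′

  initial : Numbering
  initial = (λ b → proj₁ (at b)) , λ {b} i i′ → proj₂ (at b) i i′
    where
    at : ∀ b → ∃ λ (f : Fin n → Fin Δ) → ∀ {a a′} → Inc b a → Inc b a′ → f a ≡ f a′ → a ≡ a′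
    at b with side b in eq
    ... | false = (λ _ → fromℕ< 1≤Δ) , λ { (() , _) }
    ... | true  =
      let f , injective = number-list 1≤Δ _ (degB b eq)
      in f , λ (_ , ba) (_ , ba′) → injective (nbr ba) (nbr ba′)
      where
      nbr : ∀ {a} → Adj G b a → a ∈ₗ filter (λ w → T? (adj G b w)) (V.toList (V.allFin n))
      nbr {a} ba = ∈-filter⁺ (λ w → T? (adj G b w)) (∈-toList⁺ (∈-allFin⁺ a)) ba

  Equal : (Fin n → Fin n → Fin Δ) → Fin n → Fin n → Fin n → Set
  Equal lab a x y = Inc x a × Inc y a × lab x a ≡ lab y a

  Equal? : ∀ lab a x y → Dec (Equal lab a x y)
  Equal? lab a x y = Inc? x a ×-dec (Inc? y a ×-dec lab x a ≟ lab y a)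

  -- The pairs are ordered and may have `x ≡ y`; this diagonal contributes one per edge whatever the
  -- numbering, so it does not affect the comparison.
  Φ : Numbering → ℕ
  Φ (lab , _) = sum (λ a → sum (λ x → sum (λ y → ⟦ Equal? lab a x y ⟧)))

  Φ-bound : ∀ l → Φ l ≤ sum {n} (λ _ → sum {n} (λ _ → sum {n} (λ _ → 1)))
  Φ-bound (lab , _) = sum-mono-≤ (λ a → sum-mono-≤ (λ x → sum-mono-≤ (λ y → ⟦⟧≤1 (Equal? lab a x y))))

  -- The digraphs of a numbering.

  module _ (l : Numbering) where
    private
      lab = proj₁ l
      lab-injective = proj₂ l

    Mixed : Fin n → Set
    Mixed a = ∃₂ λ x y → Inc x a × Inc y a × lab x a ≢ lab y a

    Mixed? : ∀ a → Dec (Mixed a)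
    Mixed? a = any? λ x → any? λ y → Inc? x a ×-dec (Inc? y a ×-dec ¬? (lab x a ≟ lab y a))

    Shares : Fin Δ → Fin n → Fin n → Set
    Shares i b b′ = ∃ λ a → Inc b a × Inc b′ a × lab b a ≡ i

    Shares? : ∀ i b b′ → Dec (Shares i b b′)
    Shares? i b b′ = any? λ a → Inc? b a ×-dec (Inc? b′ a ×-dec lab b a ≟ i)

    D : Fin Δ → Fin n → Fin n → Set
    D i b b′ = b ≢ b′ × Shares i b b′

    D? : ∀ i b b′ → Dec (D i b b′)
    D? i b b′ = ¬? (b ≟ b′) ×-dec Shares? i b b′

    Paired : Fin n → Fin Δ → Set
    Paired a i = ∃₂ λ x y → Inc x a × D i x y × D i y x

    Paired? : ∀ a i → Dec (Paired a i)
    Paired? a i = any? λ x → any? λ y → Inc? x a ×-dec (D? i x y ×-dec D? i y x)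

    -- The part of maximality that is needed: renumbering a mixed vertex to `i` creates an equal
    -- pair, so it must endanger an old one.
    Stable : Set
    Stable = ∀ {a} i → Mixed a → Paired a i

    module _ (a : Fin n) (i : Fin Δ) where

      -- A transposition at `x` gives `xa` the number `i` and keeps the numbers at `x` distinct.
      relabel : Fin n → Fin n → Fin Δ
      relabel x e = if does (Inc? x a) then transpose i (lab x a) (lab x e) else lab x e

      relabel-yes : ∀ {x e} → Inc x a → relabel x e ≡ transpose i (lab x a) (lab x e)
      relabel-yes {x} = if-yes (Inc? x a)

      relabel-no : ∀ {x e} → ¬ Inc x a → relabel x e ≡ lab x e
      relabel-no {x} = if-no (Inc? x a)

      relabel-injective : ∀ {x e e′} → Inc x e → Inc x e′ → relabel x e ≡ relabel x e′ → e ≡ e′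
      relabel-injective {x} xe xe′ eq with Inc? x a
      ... | yes xa = lab-injective xe xe′ (transpose-injective i (lab x a)
                       (trans (sym (relabel-yes xa)) (trans eq (relabel-yes xa))))
      ... | no ¬xa = lab-injective xe xe′ (trans (sym (relabel-no ¬xa)) (trans eq (relabel-no ¬xa)))

      relabelled : Numbering
      relabelled = relabel , relabel-injective

      relabel-at : ∀ {x} → Inc x a → relabel x a ≡ i
      relabel-at {x} xa = trans (relabel-yes xa) (transpose-right i (lab x a))

      relabel-away : ∀ {x e} → (Inc x a → lab x e ≢ i × lab x e ≢ lab x a) → relabel x e ≡ lab x e
      relabel-away {x} away with Inc? x a
      ... | yes xa = let ≢i , ≢lab = away xa in trans (relabel-yes xa) (transpose-fixed ≢i ≢lab)
      ... | no ¬xa = relabel-no ¬xa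

      module _ (unpaired : ¬ Paired a i) where

        -- Only `i` and the number of `xa` move at a neighbor `x` of `a`. If `xe` had number `i`,
        -- then so would `ye`, and `e` would witness opposite arcs between `x` and `y`; if it had
        -- the number of `xa`, injectivity would give `e ≡ a`.
        unaffected : ∀ {e x y} → e ≢ a → x ≢ y → Equal lab e x y → relabel x e ≡ lab x e
        unaffected {x = x} {y} e≢a x≢y (xe , ye , eq) = relabel-away λ xa →
          (λ ≡i → unpaired (x , y , xa , (x≢y , _ , xe , ye , ≡i) , (x≢y ∘ sym , _ , ye , xe , trans (sym eq) ≡i))) ,
          (λ ≡lab → e≢a (lab-injective xe xa ≡lab))

        Equal-preserved : ∀ {e x y} → Equal lab e x y → Equal relabel e x y
        Equal-preserved {e} {x} {y} p@(xe , ye , eq) = xe , ye , relabel-eq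
          where
          relabel-eq : relabel x e ≡ relabel y e
          relabel-eq with e ≟ a | x ≟ y
          ... | yes refl | _        = trans (relabel-at xe) (sym (relabel-at ye))
          ... | no  _    | yes refl = refl
          ... | no  e≢a  | no  x≢y  =
            trans (unaffected e≢a x≢y p) (trans eq (sym (unaffected e≢a (x≢y ∘ sym) (ye , xe , sym eq))))

        relabel-increases : Mixed a → Φ l < Φ relabelled
        relabel-increases (x , y , xa , ya , lab≢) =
          sum-mono-< (λ e → sum-mono-≤ (λ z → sum-mono-≤ (grow e z))) a
            (sum-mono-< (λ z → sum-mono-≤ (grow a z)) x
              (sum-mono-< (grow a x) y strict))
          where
          grow : ∀ e z w → ⟦ Equal? lab e z w ⟧ ≤ ⟦ Equal? relabel e z w ⟧
          grow e z w = ⟦⟧-mono (Equal? lab e z w) (Equal? relabel e z w) Equal-preserved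
          strict : ⟦ Equal? lab a x y ⟧ < ⟦ Equal? relabel a x y ⟧
          strict rewrite ⟦⟧-no (Equal? lab a x y) (lab≢ ∘ proj₂ ∘ proj₂)
            | ⟦⟧-yes (Equal? relabel a x y) (xa , ya , trans (relabel-at xa) (sym (relabel-at ya))) = ≤-refl

    stable-or-improvable : Stable ⊎ ∃ λ l′ → Φ l < Φ l′
    stable-or-improvable with any? (λ a → any? (λ i → Mixed? a ×-dec ¬? (Paired? a i)))
    ... | yes (a , i , mixed , unpaired) = inj₂ (relabelled a i , relabel-increases a i unpaired mixed)
    ... | no  none = inj₁ λ {a} i mixed →
      decidable-stable (Paired? a i) (λ unpaired → none (a , i , mixed , unpaired))

    D-loopless : ∀ i b → ¬ D i b b
    D-loopless i b (b≢b , _) = b≢b refl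

    -- By injectivity only one edge at `b` is numbered `i`. Its A-end has at most three neighbors,
    -- and counting `b` itself, which is no out-neighbor, leaves two.
    D-outdegree≤2 : ∀ i b → sum (λ b′ → ⟦ D? i b b′ ⟧) ≤ 2
    D-outdegree≤2 i b with any? (λ a → Inc? b a ×-dec lab b a ≟ i)
    ... | no none = ≤-trans (≤-reflexive (sum-zero λ b′ →
            ⟦⟧-no (D? i b b′) λ (_ , a , ba , _ , eq) → none (a , ba , eq))) z≤n
    ... | yes (a , ba , refl) = +-cancelʳ-≤ 1 _ 2 (begin
        sum out + 1                             ≡⟨ cong (sum out +_) (sym (sum-≟ b)) ⟩
        sum out + sum (λ b′ → ⟦ b ≟ b′ ⟧)       ≡⟨ sym (∑-distrib-+ out (λ b′ → ⟦ b ≟ b′ ⟧)) ⟩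
        sum (λ b′ → out b′ + ⟦ b ≟ b′ ⟧)        ≤⟨ sum-mono-≤ nbr ⟩
        sum (λ b′ → ⟦ T? (adj G a b′) ⟧)        ≡⟨ sym (length-filter-tabulate (adj G a) id) ⟩
        degree G a                              ≤⟨ degA a (Inc⇒sideA ba) ⟩
        3                                       ∎)
      where
      open ≤-Reasoning
      out : Fin n → ℕ
      out b′ = ⟦ D? (lab b a) b b′ ⟧
      nbr : ∀ b′ → out b′ + ⟦ b ≟ b′ ⟧ ≤ ⟦ T? (adj G a b′) ⟧
      nbr b′ with b ≟ b′
      ... | yes refl = ≤-reflexive (sym (⟦⟧-yes (T? (adj G a b)) (Adj-sym (proj₂ ba))))
      ... | no  _    = ≤-trans (≤-reflexive (+-identityʳ _))
        (⟦⟧-mono (Shares? (lab b a) b b′) (T? (adj G a b′)) λ (a′ , ba′ , b′a′ , eq) →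
          subst (λ z → Adj G z b′) (lab-injective ba′ ba eq) (Adj-sym (proj₂ b′a′)))

    -- If `b′a` is also numbered `i`, the arc is reversed through `a`. Otherwise `a` is mixed, and
    -- stability yields a neighbor `x` of `a` on opposite arcs; as `ba` is numbered `i`, `x` is `b`
    -- or an out-neighbor of `b`.
    D-near-opposite : Stable → ∀ i {b b′} → D i b b′ →
      ∃₂ λ x y → (b ≡ x ⊎ D i b x) × D i x y × D i y x
    D-near-opposite stable i {b} {b′} r@(b≢b′ , a , ba , b′a , eq) with lab b′ a ≟ i
    ... | yes eq′ = b , b′ , inj₁ refl , r , (b≢b′ ∘ sym , a , b′a , ba , eq′)
    ... | no  neq
      with x , y , xa , xy , yx ← stable i (b , b′ , ba , b′a , λ lab≡ → neq (trans (sym lab≡) eq))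
      with b ≟ x
    ... | yes b≡x = x , y , inj₁ b≡x , xy , yx
    ... | no  b≢x = x , y , inj₂ (b≢x , a , ba , xa , eq) , xy , yx

  stable-numbering : ∃ Stable
  stable-numbering = maximize Φ _ Φ-bound stable-or-improvable initial

  -- Assembling the palettes.

  module Palettes (numbering : Numbering) (c : Fin Δ → Fin n → Fin 4)
    (proper : ∀ {i u v} → D numbering i u v → c i u ≢ c i v) where

    lab : Fin n → Fin n → Fin Δ
    lab = proj₁ numbering

    color : Fin n → Fin n → Fin (4 * Δ)
    color b a = combine (c (lab b a) b) (lab b a)

    color-injective : ∀ b a b′ a′ → color b a ≡ color b′ a′ →
      c (lab b a) b ≡ c (lab b′ a′) b′ × lab b a ≡ lab b′ a′
    color-injective b a b′ a′ = combine-injective (c (lab b a) b) (lab b a) (c (lab b′ a′) b′) (lab b′ a′)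

    -- The edge `b′a` covers every conflict: it joins the two edges, or is one of them when they
    -- share an end. Equal colors mean equal numbers, so for `b ≢ b′` it yields an arc of `D`, along
    -- which `c` is proper.
    same-color⇒same-flag : ∀ {b a b′ a′} → Inc b a → Inc b′ a′ → Inc b′ a →
      color b a ≡ color b′ a′ → b ≡ b′ × a ≡ a′
    same-color⇒same-flag {b} {a} {b′} {a′} ba b′a′ b′a eq
      with c≡ , lab≡ ← color-injective b a b′ a′ eq
      with b ≟ b′
    ... | yes refl = refl , proj₂ numbering ba b′a′ lab≡
    ... | no  b≢b′ = contradiction (trans c≡ (cong (λ i → c i b′) (sym lab≡)))
                                   (proper (b≢b′ , a , ba , b′a , refl))

    col : Fin n → Fin n → Fin (4 * Δ)
    col u v = if side u then color u v else color v u

    other-side : ∀ {u v} → Adj G u v → side v ≡ not (side u)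
    other-side {u} {v} uv = ¬-not (crossing u v uv ∘ sym)

    col-symmetric : ∀ u v → Adj G u v → col u v ≡ col v u
    col-symmetric u v uv rewrite other-side uv with side u
    ... | true  = refl
    ... | false = refl

    col-strong : ∀ u v x y → Adj G u v → Adj G x y → ¬ SameEdge u v x y →
      (u ≡ x ⊎ Adj G u x) → col u v ≢ col x y
    col-strong u v x y uv xy distinct near eq with side u in su | side x in sx | near
    ... | true  | true  | inj₁ refl =
      distinct (inj₁ (same-color⇒same-flag (su , uv) (su , xy) (su , uv) eq))
    ... | false | false | inj₁ refl =
      let v≡y , u≡u = same-color⇒same-flag (sv , Adj-sym uv) (sy , Adj-sym xy) (sy , Adj-sym xy) eq
      in distinct (inj₁ (u≡u , v≡y))
      where
      sv : side v ≡ true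
      sv = trans (other-side uv) (cong not su)
      sy : side y ≡ true
      sy = trans (other-side xy) (cong not sx)
    ... | true  | false | inj₁ refl = contradiction (trans (sym su) sx) (λ ())
    ... | false | true  | inj₁ refl = contradiction (trans (sym su) sx) (λ ())
    ... | true  | true  | inj₂ ux = crossing u x ux (trans su (sym sx))
    ... | false | false | inj₂ ux = crossing u x ux (trans su (sym sx))
    -- The joining edge `ux` has its B-end on `uv` and its A-end on `xy`, so `xy` takes the first
    -- place and the equation is reversed.
    ... | true  | false | inj₂ ux =
      let y≡u , x≡v = same-color⇒same-flag (trans (other-side xy) (cong not sx) , Adj-sym xy) (su , uv) (su , ux) (sym eq)
      in distinct (inj₂ (sym y≡u , sym x≡v))
    ... | false | true  | inj₂ ux =
      let v≡x , u≡y = same-color⇒same-flag (trans (other-side uv) (cong not su) , Adj-sym uv) (sx , xy) (sx , Adj-sym ux) eq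
      in distinct (inj₂ (u≡y , v≡x))

    coloring : StrongEdgeColoring G (4 * Δ)
    coloring = record { col = col ; col-sym = col-symmetric ; strong = col-strong }

  strong-coloring : StrongEdgeColoring G (4 * Δ)
  strong-coloring =
    let numbering , stable = stable-numbering
        palette i = FourColoring.four-colorable (D? numbering i) (D-loopless numbering i)
                      (D-outdegree≤2 numbering i) (D-near-opposite numbering stable i)
    in Palettes.coloring numbering (proj₁ ∘ palette) (λ {i} → proj₂ (palette i))

theorem3 : (Δ : ℕ) → 1 ≤ Δ → (n : ℕ) → (G : Graph n) →
    IsBipartiteWith G 3 Δ → StrongChromaticIndex≤ G (4 * Δ)
theorem3 Δ 1≤Δ n G bip = Bipartite.strong-coloring Δ 1≤Δ G bip
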